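{- There is an absolute constant $C>0$ such that for all integers $n\ge 2$ and $w\ge 2$ the following holds. Let $f:\{0,1\}^n\to\{0,1\}$ be computed by a width-$w$, length-$n$, read-once, oblivious branching program. Then $$L^1(f)=\sum_{i\in[n]}|\widehat f[\{i\}]|\le C\cdot (C\log_2 n)^{w-2}.$$
   Context: For $f:\{0,1\}^n\to\mathbb{R}$ and $s\subseteq[n]$, $\widehat f[s]=\mathbb{E}_U[f(U)(-1)^{\sum_{i\in s}U_i}]$ with $U$ uniform on $\{0,1\}^n$. A length-$n$, width-$w$ ordered branching program has layers of vertices $V_0,\dots,V_n$ with $|V_i|\le w$ and transition maps $T_i:V_{i-1}\times\{0,1\}\to V_i$; on input $x$ it starts at a fixed $u_0\in V_0$ and follows $T_i(\cdot,x_i)$; it computes $f$ if for some $S\subseteq V_n$, $f(x)=1$ iff the final vertex lies in $S$. A read-once, oblivious branching program computes $x\mapsto f'(\pi(x))$ where $f'$ is computed by an ordered branching program and $\pi$ permutes the coordinates. -}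

module Defs where

open import Data.Bool using (Bool; true; false; if_then_else_; _xor_; _∧_)
open import Data.Nat using (ℕ; zero; suc; _^_)
open import Data.Nat.Properties using (m^n≢0)
open import Data.Integer using (+_)
open import Data.Fin using (Fin; zero; suc)
open import Data.Fin.Subset using (Subset; ⁅_⁆)
open import Data.Fin.Permutation using (Permutation′; _⟨$⟩ʳ_)
open import Data.Vec using (Vec; []; _∷_; lookup; tabulate; zipWith; foldr)
open import Data.List using (List; []; _∷_; map; _++_; allFin)
import Data.List as List
open import Data.Rational using (ℚ; 0ℚ; 1ℚ; -_; _+_; _*_; _/_; ∣_∣)
open import Data.Product using (Σ; _×_)
open import Relation.Binary.PropositionalEquality using (_≡_)

allInputs : (n : ℕ) → List (Vec Bool n)
allInputs zero = [] ∷ []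
allInputs (suc n) = map (false ∷_) (allInputs n) ++ map (true ∷_) (allInputs n)

sumℚ : List ℚ → ℚ
sumℚ = List.foldr _+_ 0ℚ

expect : (n : ℕ) → (Vec Bool n → ℚ) → ℚ
expect n g = sumℚ (map g (allInputs n)) * _/_ (+ 1) (2 ^ n) {{m^n≢0 2 n}}

parity : {n : ℕ} → Subset n → Vec Bool n → Bool
parity s x = foldr _ _xor_ false (zipWith _∧_ s x)

character : {n : ℕ} → Subset n → Vec Bool n → ℚ
character s x = if parity s x then - 1ℚ else 1ℚ

fourier : {n : ℕ} → (Vec Bool n → ℚ) → Subset n → ℚ
fourier {n} f s = expect n (λ x → f x * character s x)

boolToℚ : Bool → ℚ
boolToℚ b = if b then 1ℚ else 0ℚ

L1 : {n : ℕ} → (Vec Bool n → Bool) → ℚ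
L1 {n} f = sumℚ (map (λ i → ∣ fourier (λ x → boolToℚ (f x)) ⁅ i ⁆ ∣) (allFin n))

-- Length-n, width-w ordered branching program. Every layer V_i is
-- (embedded in) Fin w, so |V_i| ≤ w.
record OBP (n w : ℕ) : Set where
  field
    start  : Fin w
    trans  : Fin n → Fin w → Bool → Fin w   -- T_{i+1} : V_i × {0,1} → V_{i+1}
    accept : Fin w → Bool

run : {n w : ℕ} → (Fin n → Fin w → Bool → Fin w) → Fin w → Vec Bool n → Fin w
run T u [] = u
run T u (b ∷ xs) = run (λ i → T (suc i)) (T zero u b) xs

evalOBP : {n w : ℕ} → OBP n w → Vec Bool n → Bool
evalOBP B x = OBP.accept B (run (OBP.trans B) (OBP.start B) x)

permuteInput : {n : ℕ} → Permutation′ n → Vec Bool n → Vec Bool n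
permuteInput σ x = tabulate (λ i → lookup x (σ ⟨$⟩ʳ i))

ComputedByROBP : (n w : ℕ) → (Vec Bool n → Bool) → Set
ComputedByROBP n w f =
  Σ (OBP n w) λ B → Σ (Permutation′ n) λ σ →
    (x : Vec Bool n) → f x ≡ evalOBP B (permuteInput σ x)

{-# OPTIONS --safe #-}
-- L¹ does not depend on the order of the bits, and it is at most the expected total variation var of the
-- martingale of acceptance probabilities val along a run of the program.
--
-- Width 2: each step's variation is paid for by a decrease of the distance between the two values, so var ≤ 1.
--
-- Width w ≥ 3: relabel the edges so that the 1-successor never has the smaller value. A layer both of whose maps
-- are then injective has zero variation, because the values at its two ends have the same sum; so every
-- remaining layer has a non-injective map. Split the layers into 2L+1 residue classes, where n ≤ 2^L. By
-- convexity, the variation of one class is at most that of the program in which all other bits are fixed at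
-- random. Between two consecutive live layers there are 2L fixed ones, and unless all of them picked
-- an injective map (probability at most 2^(-2L)), the composite map factors through w-1 vertices.
-- Hence B(w) ≤ (2L+1)(B(w-1)+1).
module Submission where

open import Defs

module TotalVariation where

  open import Data.Rational
  open import Data.Rational.Properties
  open import Data.Rational.Solver using (module +-*-Solver)
  open +-*-Solver using (solve; _:=_; _:+_; _:*_; _:-_; con)
  open import Algebra.Properties.CommutativeMonoid.Sum +-0-commutativeMonoid using (sum; sum-remove; sum-permute; sum-cong-≗)
  open import Data.Bool using (Bool; true; false; if_then_else_; not; _∨_)
  open import Data.Fin using (Fin; zero; suc; punchOut; punchIn)
  open import Data.Fin.Permutation using (Permutation′; _⟨$⟩ʳ_; _⟨$⟩ˡ_; flip; inverseˡ; inverseʳ)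
  open import Data.Fin.Properties using (any?; punchIn-punchOut; punchOut-injective) renaming (_≟_ to _≟ᶠ_; suc-injective to sucᶠ-injective)
  open import Data.Fin.Subset using (⁅_⁆; ⊥)
  import Data.Integer as ℤ
  import Data.Integer.Properties as ℤ
  import Data.List as List
  open List using (List; []; _∷_; _++_; map; allFin)
  open import Data.List.Membership.Propositional using (_∈_)
  open import Data.List.Membership.Propositional.Properties using (∈-map⁺; ∈-map⁻; ∈-++⁺ˡ; ∈-++⁺ʳ)
  open import Data.List.Membership.Propositional.Properties.WithK using (unique∧set⇒bag)
  open import Data.List.Properties using (map-++; map-∘; map-tabulate)
  open import Data.List.Relation.Binary.BagAndSetEquality using (∼bag⇒↭)
  open import Data.List.Relation.Binary.Permutation.Propositional as ↭ using (_↭_)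
  open import Data.List.Relation.Binary.Permutation.Propositional.Properties using () renaming (map⁺ to ↭-map⁺)
  import Data.List.Relation.Unary.All as ListAll
  import Data.List.Relation.Unary.AllPairs as AllPairs
  open import Data.List.Relation.Unary.Any using (here)
  open import Data.List.Relation.Unary.Unique.Propositional using (Unique)
  import Data.List.Relation.Unary.Unique.Propositional.Properties as Unique
  open import Data.Nat as ℕ using (ℕ; zero; suc; ⌊_/2⌋; ⌈_/2⌉)
  open import Data.Nat.Induction using (<-rec)
  open import Data.Nat.Logarithm using (⌈log₂_⌉; ⌈log₂⌉-mono-≤; ⌈log₂⌈n/2⌉⌉≡⌈log₂n⌉∸1)
  import Data.Nat.Properties as ℕ
  open import Data.Nat.Tactic.RingSolver using (solve-∀)
  open import Data.Product using (∃; ∃₂; _×_; _,_; proj₁; proj₂)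
  import Data.Rational.Unnormalised as ℚᵘ
  import Data.Rational.Unnormalised.Properties as ℚᵘ
  open import Data.Sum using (_⊎_; inj₁; inj₂)
  open import Data.Vec using (Vec; []; _∷_; lookup; tabulate)
  open import Data.Vec.Functional using (removeAt)
  open import Data.Vec.Properties using (tabulate-cong; tabulate∘lookup; lookup∘tabulate; ∷-injectiveʳ)
  open import Data.Vec.Relation.Unary.All using (All; []; _∷_)
  open import Function using (_∘_; id; Injective; mk⇔)
  open import Relation.Binary.PropositionalEquality
  import Relation.Binary.Reasoning.Setoid as SetoidReasoning
  open import Relation.Nullary using (¬_; Dec; yes; no; does; contradiction; ¬?; _×-dec_)
  open import Relation.Nullary.Decidable using (decidable-stable)

  private variable
    n w : ℕ

  -- Averages and half-differences of rationals.

  avg : ℚ → ℚ → ℚ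
  avg p q = ½ * (p + q)

  gap : ℚ → ℚ → ℚ
  gap p q = ½ * ∣ p - q ∣

  ½*-mono : ∀ {p q} → p ≤ q → ½ * p ≤ ½ * q
  ½*-mono = *-monoˡ-≤-nonNeg ½

  avg-mono : ∀ {p q r s} → p ≤ r → q ≤ s → avg p q ≤ avg r s
  avg-mono p≤r q≤s = ½*-mono (+-mono-≤ p≤r q≤s)

  avg-idem : ∀ p → avg p p ≡ p
  avg-idem = solve 1 (λ p → con ½ :* (p :+ p) := p) refl

  avg-+ : ∀ p q r s → avg (p + r) (q + s) ≡ avg p q + avg r s
  avg-+ = solve 4 (λ p q r s → con ½ :* ((p :+ r) :+ (q :+ s)) := con ½ :* (p :+ q) :+ con ½ :* (r :+ s)) refl

  avg-- : ∀ p q r s → avg p q - avg r s ≡ avg (p - r) (q - s)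
  avg-- = solve 4 (λ p q r s → con ½ :* (p :+ q) :- con ½ :* (r :+ s) := con ½ :* ((p :- r) :+ (q :- s))) refl

  ∣½*∣ : ∀ p → ∣ ½ * p ∣ ≡ ½ * ∣ p ∣
  ∣½*∣ p = ∣p*q∣≡∣p∣*∣q∣ ½ p

  ∣avg∣≤ : ∀ p q → ∣ avg p q ∣ ≤ avg ∣ p ∣ ∣ q ∣
  ∣avg∣≤ p q = ≤-trans (≤-reflexive (∣½*∣ (p + q))) (½*-mono (∣p+q∣≤∣p∣+∣q∣ p q))

  ∣-∣-sym : ∀ p q → ∣ p - q ∣ ≡ ∣ q - p ∣
  ∣-∣-sym p q = trans (cong ∣_∣ (solve 2 (λ p q → p :- q := con (- 1ℚ) :* (q :- p)) refl p q))
                (trans (∣p*q∣≡∣p∣*∣q∣ (- 1ℚ) (q - p)) (*-identityˡ _))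

  gap-sym : ∀ p q → gap p q ≡ gap q p
  gap-sym p q = cong (½ *_) (∣-∣-sym p q)

  ∣p-p∣≡0 : ∀ p → ∣ p - p ∣ ≡ 0ℚ
  ∣p-p∣≡0 p = cong ∣_∣ (+-inverseʳ p)

  gap-refl : ∀ p → gap p p ≡ 0ℚ
  gap-refl p = cong (½ *_) (∣p-p∣≡0 p)

  gap-avg≤ : ∀ p q r s → gap (avg p q) (avg r s) ≤ avg (gap p r) (gap q s)
  gap-avg≤ p q r s = begin
    gap (avg p q) (avg r s)         ≡⟨ cong (λ t → ½ * ∣ t ∣) (avg-- p q r s) ⟩
    ½ * ∣ avg (p - r) (q - s) ∣     ≤⟨ ½*-mono (∣avg∣≤ (p - r) (q - s)) ⟩
    ½ * avg ∣ p - r ∣ ∣ q - s ∣     ≡⟨ solve 2 (λ a b → con ½ :* (con ½ :* (a :+ b)) := con ½ :* (con ½ :* a :+ con ½ :* b)) refl ∣ p - r ∣ ∣ q - s ∣ ⟩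
    avg (gap p r) (gap q s)         ∎
    where open ≤-Reasoning

  0≤1 : 0ℚ ≤ 1ℚ
  0≤1 = *≤* (ℤ.+≤+ ℕ.z≤n)

  ∣p-q∣≤1 : ∀ {p q} → 0ℚ ≤ p → p ≤ 1ℚ → 0ℚ ≤ q → q ≤ 1ℚ → ∣ p - q ∣ ≤ 1ℚ
  ∣p-q∣≤1 {p} {q} 0≤p p≤1 0≤q q≤1 with ∣p∣≡p∨∣p∣≡-p (p - q)
  ... | inj₁ eq = ≤-trans (≤-reflexive eq) (+-mono-≤ p≤1 (neg-antimono-≤ 0≤q))
  ... | inj₂ eq = ≤-trans (≤-reflexive (trans eq (solve 2 (λ p q → con 0ℚ :- (p :- q) := q :- p) refl p q ⟨≡⟩)))
                   (+-mono-≤ q≤1 (neg-antimono-≤ 0≤p))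
    where _⟨≡⟩ : ∀ {a b} → 0ℚ - a ≡ b → - a ≡ b
          _⟨≡⟩ {a} e = trans (sym (+-identityˡ (- a))) e

  -- Natural numbers and powers of one half as rationals.

  ι : ℕ → ℚ
  ι zero    = 0ℚ
  ι (suc n) = 1ℚ + ι n

  0≤ι : ∀ n → 0ℚ ≤ ι n
  0≤ι zero    = ≤-refl
  0≤ι (suc n) = +-mono-≤ 0≤1 (0≤ι n)

  ι-+ : ∀ m n → ι (m ℕ.+ n) ≡ ι m + ι n
  ι-+ zero    n = sym (+-identityˡ (ι n))
  ι-+ (suc m) n = trans (cong (1ℚ +_) (ι-+ m n)) (sym (+-assoc 1ℚ (ι m) (ι n)))

  ι-* : ∀ m n → ι (m ℕ.* n) ≡ ι m * ι n
  ι-* zero    n = sym (*-zeroˡ (ι n))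
  ι-* (suc m) n = trans (ι-+ n (m ℕ.* n)) (trans (cong (ι n +_) (ι-* m n))
    (solve 2 (λ a b → b :+ a :* b := (con 1ℚ :+ a) :* b) refl (ι m) (ι n)))

  ι-mono : ∀ {m n} → m ℕ.≤ n → ι m ≤ ι n
  ι-mono {n = n} ℕ.z≤n     = 0≤ι n
  ι-mono         (ℕ.s≤s p) = +-monoʳ-≤ 1ℚ (ι-mono p)

  -- Links the recursive embedding with the quotient in the theorem. Passing to unnormalised
  -- rationals avoids the gcd in `_/_`.
  ι≡/1 : ∀ n → ι n ≡ ℤ.+ n / 1
  ι≡/1 zero    = refl
  ι≡/1 (suc n) = trans (cong (1ℚ +_) (ι≡/1 n)) (toℚᵘ-injective (begin
    toℚᵘ (1ℚ + ℤ.+ n / 1)          ≈⟨ toℚᵘ-homo-+ 1ℚ (ℤ.+ n / 1) ⟩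
    ℚᵘ.1ℚᵘ ℚᵘ.+ toℚᵘ (ℤ.+ n / 1)    ≈⟨ ℚᵘ.+-congʳ ℚᵘ.1ℚᵘ (toℚᵘ-fromℚᵘ (ℚᵘ.mkℚᵘ (ℤ.+ n) 0)) ⟩
    ℚᵘ.1ℚᵘ ℚᵘ.+ ℚᵘ.mkℚᵘ (ℤ.+ n) 0   ≈⟨ ℚᵘ.*≡* (cong (λ k → (ℤ.+ 1 ℤ.+ k) ℤ.* ℤ.+ 1) (ℤ.*-identityʳ (ℤ.+ n))) ⟩
    ℚᵘ.mkℚᵘ (ℤ.+ suc n) 0          ≈⟨ toℚᵘ-fromℚᵘ (ℚᵘ.mkℚᵘ (ℤ.+ suc n) 0) ⟨
    toℚᵘ (ℤ.+ suc n / 1)           ∎))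
    where open SetoidReasoning ℚᵘ.≃-setoid

  ½^ : ℕ → ℚ
  ½^ zero    = 1ℚ
  ½^ (suc n) = ½ * ½^ n

  0≤½^ : ∀ n → 0ℚ ≤ ½^ n
  0≤½^ zero    = 0≤1
  0≤½^ (suc n) = ½*-mono (0≤½^ n)

  ½^-+ : ∀ m n → ½^ (m ℕ.+ n) ≡ ½^ m * ½^ n
  ½^-+ zero    n = sym (*-identityˡ (½^ n))
  ½^-+ (suc m) n = trans (cong (½ *_) (½^-+ m n)) (sym (*-assoc ½ (½^ m) (½^ n)))

  ι2^*½^ : ∀ n → ι (2 ℕ.^ n) * ½^ n ≡ 1ℚ
  ι2^*½^ zero    = refl
  ι2^*½^ (suc n) = begin
    ι (2 ℕ.* 2 ℕ.^ n) * (½ * ½^ n)   ≡⟨ cong (_* (½ * ½^ n)) (ι-* 2 (2 ℕ.^ n)) ⟩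
    (ι 2 * ι (2 ℕ.^ n)) * (½ * ½^ n) ≡⟨ solve 2 (λ a b → (con (ι 2) :* a) :* (con ½ :* b) := a :* b) refl (ι (2 ℕ.^ n)) (½^ n) ⟩
    ι (2 ℕ.^ n) * ½^ n               ≡⟨ ι2^*½^ n ⟩
    1ℚ                               ∎
    where open ≡-Reasoning

  -- Inverses of `2 ^ n` are unique, and `ι2^*½^` shows that `½^ n` is one.
  1/2^≡½^ : ∀ n → _/_ (ℤ.+ 1) (2 ℕ.^ n) {{ℕ.m^n≢0 2 n}} ≡ ½^ n
  1/2^≡½^ n = begin
    r                          ≡⟨ *-identityʳ r ⟨
    r * 1ℚ                     ≡⟨ cong (r *_) (ι2^*½^ n) ⟨
    r * (ι (2 ℕ.^ n) * ½^ n)   ≡⟨ *-assoc r (ι (2 ℕ.^ n)) (½^ n) ⟨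
    (r * ι (2 ℕ.^ n)) * ½^ n   ≡⟨ cong (_* ½^ n) (recip (2 ℕ.^ n) {{ℕ.m^n≢0 2 n}}) ⟩
    1ℚ * ½^ n                  ≡⟨ *-identityˡ (½^ n) ⟩
    ½^ n                       ∎
    where
    open ≡-Reasoning
    r = _/_ (ℤ.+ 1) (2 ℕ.^ n) {{ℕ.m^n≢0 2 n}}
    recip : ∀ m .{{_ : ℕ.NonZero m}} → ℤ.+ 1 / m * ι m ≡ 1ℚ
    recip m@(suc k) = toℚᵘ-injective (ℚᵘ.≃-trans (toℚᵘ-homo-* (ℤ.+ 1 / m) (ι m))
      (ℚᵘ.≃-trans (ℚᵘ.*-cong (toℚᵘ-fromℚᵘ (ℚᵘ.mkℚᵘ (ℤ.+ 1) k))
        (ℚᵘ.≃-trans (ℚᵘ.≃-reflexive (cong toℚᵘ (ι≡/1 m))) (toℚᵘ-fromℚᵘ (ℚᵘ.mkℚᵘ (ℤ.+ m) 0))))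
      (ℚᵘ.*≡* (ℤ.*-assoc (ℤ.+ 1) (ℤ.+ m) (ℤ.+ 1)))))

  0≤* : ∀ {p q} → 0ℚ ≤ p → 0ℚ ≤ q → 0ℚ ≤ p * q
  0≤* {p} {q} 0≤p 0≤q = ≤-trans (≤-reflexive (sym (*-zeroˡ q))) (*-monoʳ-≤-nonNeg q {{nonNegative 0≤q}} 0≤p)

  -- Values and variation of layered programs.

  Layer : ℕ → Set
  Layer w = Fin w → Bool → Fin w

  val : Vec (Layer w) n → (Fin w → Bool) → Fin w → ℚ
  val []       a v = boolToℚ (a v)
  val (T ∷ Ts) a v = avg (val Ts a (T v false)) (val Ts a (T v true))

  -- Expected total variation of the martingale of acceptance probabilities: from v it moves by ±gap.
  var : Vec (Layer w) n → (Fin w → Bool) → Fin w → ℚ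
  var []       a v = 0ℚ
  var (T ∷ Ts) a v = gap (val Ts a (T v false)) (val Ts a (T v true))
                   + avg (var Ts a (T v false)) (var Ts a (T v true))

  0≤boolToℚ : ∀ b → 0ℚ ≤ boolToℚ b
  0≤boolToℚ false = ≤-refl
  0≤boolToℚ true  = 0≤1

  boolToℚ≤1 : ∀ b → boolToℚ b ≤ 1ℚ
  boolToℚ≤1 false = 0≤1
  boolToℚ≤1 true  = ≤-refl

  -- Width two.

  ∣p-avg∣≤ : ∀ {p q r R} → ∣ p - q ∣ ≤ R → ∣ p - r ∣ ≤ R → ∣ p - avg q r ∣ ≤ R
  ∣p-avg∣≤ {p} {q} {r} {R} pq pr = begin
    ∣ p - avg q r ∣          ≡⟨ cong (λ t → ∣ t - avg q r ∣) (avg-idem p) ⟨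
    ∣ avg p p - avg q r ∣    ≡⟨ cong ∣_∣ (avg-- p p q r) ⟩
    ∣ avg (p - q) (p - r) ∣  ≤⟨ ∣avg∣≤ (p - q) (p - r) ⟩
    avg ∣ p - q ∣ ∣ p - r ∣  ≤⟨ avg-mono pq pr ⟩
    avg R R                  ≡⟨ avg-idem R ⟩
    R                        ∎
    where open ≤-Reasoning

  ∣avg-avg∣-shareˡ : ∀ p q s → ∣ avg p q - avg p s ∣ ≡ gap q s
  ∣avg-avg∣-shareˡ p q s = trans
    (cong ∣_∣ (solve 3 (λ p q s → con ½ :* (p :+ q) :- con ½ :* (p :+ s) := con ½ :* (q :- s)) refl p q s))
    (∣½*∣ (q - s))

  ∣avg-avg∣-shareʳ : ∀ p q s → ∣ avg p q - avg q s ∣ ≡ gap p s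
  ∣avg-avg∣-shareʳ p q s = trans
    (cong ∣_∣ (solve 3 (λ p q s → con ½ :* (p :+ q) :- con ½ :* (q :+ s) := con ½ :* (p :- s)) refl p q s))
    (∣½*∣ (p - s))

  module _ (p : Fin 2 → ℚ) where

    private R = ∣ p zero - p (suc zero) ∣

    ∣p-p∣≤R : ∀ i j → ∣ p i - p j ∣ ≤ R
    ∣p-p∣≤R zero       zero       = ≤-trans (≤-reflexive (∣p-p∣≡0 (p zero))) (0≤∣p∣ (p zero - p (suc zero)))
    ∣p-p∣≤R zero       (suc zero) = ≤-refl
    ∣p-p∣≤R (suc zero) zero       = ≤-reflexive (∣-∣-sym (p (suc zero)) (p zero))
    ∣p-p∣≤R (suc zero) (suc zero) = ≤-trans (≤-reflexive (∣p-p∣≡0 (p (suc zero)))) (0≤∣p∣ (p zero - p (suc zero)))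

    private
      halves : ∀ {x y} → x ≤ ½ * R → y ≤ ½ * R → x + y ≤ R
      halves x≤ y≤ = ≤-trans (+-mono-≤ x≤ y≤) (≤-reflexive
        (solve 1 (λ R → con ½ :* R :+ con ½ :* R := R) refl R))

    -- If `a ≡ b`, the gap vanishes and both averages lie between the two values. Otherwise `a` and
    -- `b` are all the vertices, so `c` is one of them; the averages then share a term, and the gap
    -- and their distance are each at most `½ * R`.
    gap+∣avg-avg∣≤ : ∀ a b c d →
      gap (p a) (p b) + ∣ avg (p a) (p b) - avg (p c) (p d) ∣ ≤ R
    gap+∣avg-avg∣≤ a b c d with a ≟ᶠ b
    ... | yes refl = begin
      gap (p a) (p a) + ∣ avg (p a) (p a) - avg (p c) (p d) ∣
        ≡⟨ cong₂ (λ s t → s + ∣ t - avg (p c) (p d) ∣) (gap-refl (p a)) (avg-idem (p a)) ⟩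
      0ℚ + ∣ p a - avg (p c) (p d) ∣  ≡⟨ +-identityˡ _ ⟩
      ∣ p a - avg (p c) (p d) ∣       ≤⟨ ∣p-avg∣≤ {p = p a} (∣p-p∣≤R a c) (∣p-p∣≤R a d) ⟩
      R                               ∎
      where open ≤-Reasoning
    ... | no a≢b with c≡a⊎c≡b a b c a≢b
      where
      c≡a⊎c≡b : ∀ (a b c : Fin 2) → ¬ (a ≡ b) → c ≡ a ⊎ c ≡ b
      c≡a⊎c≡b zero       zero       c          a≢b = contradiction refl a≢b
      c≡a⊎c≡b (suc zero) (suc zero) c          a≢b = contradiction refl a≢b
      c≡a⊎c≡b zero       (suc zero) zero       a≢b = inj₁ refl
      c≡a⊎c≡b zero       (suc zero) (suc zero) a≢b = inj₂ refl
      c≡a⊎c≡b (suc zero) zero       zero       a≢b = inj₂ refl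
      c≡a⊎c≡b (suc zero) zero       (suc zero) a≢b = inj₁ refl
    ... | inj₁ refl = halves (½*-mono (∣p-p∣≤R a b))
      (≤-trans (≤-reflexive (∣avg-avg∣-shareˡ (p a) (p b) (p d))) (½*-mono (∣p-p∣≤R b d)))
    ... | inj₂ refl = halves (½*-mono (∣p-p∣≤R a b))
      (≤-trans (≤-reflexive (∣avg-avg∣-shareʳ (p a) (p b) (p d))) (½*-mono (∣p-p∣≤R a d)))

  -- Only the distance between the two values can pay for variation, and it never grows towards the start.
  var+∣val-val∣≤1 : (Ts : Vec (Layer 2) n) (a : Fin 2 → Bool) (v : Fin 2) →
    var Ts a v + ∣ val Ts a zero - val Ts a (suc zero) ∣ ≤ 1ℚ
  var+∣val-val∣≤1 [] a v = ≤-trans (≤-reflexive (+-identityˡ _))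
    (∣p-q∣≤1 (0≤boolToℚ (a zero)) (boolToℚ≤1 (a zero)) (0≤boolToℚ (a (suc zero))) (boolToℚ≤1 (a (suc zero))))
  var+∣val-val∣≤1 (T ∷ Ts) a v = begin
    gap (p x) (p y) + avg (u x) (u y) + D
      ≡⟨ solve 3 (λ g s d → g :+ s :+ d := s :+ (g :+ d)) refl (gap (p x) (p y)) (avg (u x) (u y)) D ⟩
    avg (u x) (u y) + (gap (p x) (p y) + D)  ≤⟨ +-monoʳ-≤ (avg (u x) (u y)) (drop v) ⟩
    avg (u x) (u y) + R                      ≡⟨ cong (avg (u x) (u y) +_) (avg-idem R) ⟨
    avg (u x) (u y) + avg R R                ≡⟨ avg-+ (u x) (u y) R R ⟨
    avg (u x + R) (u y + R)                  ≤⟨ avg-mono (var+∣val-val∣≤1 Ts a x) (var+∣val-val∣≤1 Ts a y) ⟩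
    avg 1ℚ 1ℚ                                ≡⟨⟩
    1ℚ                                       ∎
    where
    open ≤-Reasoning
    p = val Ts a
    u = var Ts a
    x = T v false
    y = T v true
    R = ∣ p zero - p (suc zero) ∣
    D = ∣ val (T ∷ Ts) a zero - val (T ∷ Ts) a (suc zero) ∣
    -- Either vertex can be `v`; the other one supplies `c` and `d`, and swapping the two leaves `D`
    -- unchanged.
    drop : ∀ v → gap (p (T v false)) (p (T v true)) + D ≤ R
    drop zero       = gap+∣avg-avg∣≤ p _ _ _ _
    drop (suc zero) = ≤-trans
      (≤-reflexive (cong (gap (p (T (suc zero) false)) (p (T (suc zero) true)) +_) (∣-∣-sym (val (T ∷ Ts) a zero) (val (T ∷ Ts) a (suc zero)))))
      (gap+∣avg-avg∣≤ p (T (suc zero) false) (T (suc zero) true) (T zero false) (T zero true))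

  var₂≤1 : (Ts : Vec (Layer 2) n) (a : Fin 2 → Bool) (v : Fin 2) → var Ts a v ≤ 1ℚ
  var₂≤1 Ts a v = ≤-trans
    (≤-trans (≤-reflexive (sym (+-identityʳ _))) (+-monoʳ-≤ (var Ts a v) (0≤∣p∣ (val Ts a zero - val Ts a (suc zero)))))
    (var+∣val-val∣≤1 Ts a v)

  avg≤larger : (f : Bool → ℚ) → ∃ λ b → avg (f false) (f true) ≤ f b
  avg≤larger f with ≤-total (f false) (f true)
  ... | inj₁ le = true  , ≤-trans (avg-mono le (≤-refl {f true})) (≤-reflexive (avg-idem (f true)))
  ... | inj₂ le = false , ≤-trans (avg-mono (≤-refl {f false}) le) (≤-reflexive (avg-idem (f false)))

  -- Collisions

  Collides : (Fin w → Fin w) → Set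
  Collides g = ∃₂ λ i j → ¬ (i ≡ j) × g i ≡ g j

  abstract
    collides? : (g : Fin w → Fin w) → Dec (Collides g)
    collides? g = any? λ i → any? λ j → ¬? (i ≟ᶠ j) ×-dec (g i ≟ᶠ g j)

  ¬collides⇒injective : {g : Fin w → Fin w} → ¬ Collides g → Injective _≡_ _≡_ g
  ¬collides⇒injective ¬c {i} {j} eq = decidable-stable (i ≟ᶠ j) λ i≢j → ¬c (i , j , i≢j , eq)

  Colliding : Layer w → Set
  Colliding T = ∃ λ b → Collides λ v → T v b

  -- An injective self-map of a finite set is a permutation. Splitting off `π zero` and closing the
  -- hole with `punchOut` leaves an injective self-map of a set with one element fewer.
  sum-injective : (p : Fin n → ℚ) (π : Fin n → Fin n) → Injective _≡_ _≡_ π → sum (p ∘ π) ≡ sum p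
  sum-injective {zero}  p π inj = refl
  sum-injective {suc n} p π inj = begin
    p (π zero) + sum (p ∘ π ∘ suc)           ≡⟨ cong (p (π zero) +_) (sum-cong-≗ λ i → cong p (sym (punchIn-punchOut (π0≢ i)))) ⟩
    p (π zero) + sum (removeAt p (π zero) ∘ π′) ≡⟨ cong (p (π zero) +_) (sum-injective (removeAt p (π zero)) π′ inj′) ⟩
    p (π zero) + sum (removeAt p (π zero))   ≡⟨ sum-remove p ⟨
    sum p                                    ∎
    where
    open ≡-Reasoning
    π0≢ : ∀ i → ¬ (π zero ≡ π (suc i))
    π0≢ i eq with () ← inj eq
    π′ : Fin n → Fin n
    π′ i = punchOut (π0≢ i)
    inj′ : Injective _≡_ _≡_ π′
    inj′ eq = sucᶠ-injective (inj (punchOut-injective (π0≢ _) (π0≢ _) eq))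

  sum-mono : {f g : Fin n → ℚ} → (∀ i → f i ≤ g i) → sum f ≤ sum g
  sum-mono {zero}  f≤g = ≤-refl
  sum-mono {suc n} f≤g = +-mono-≤ (f≤g zero) (sum-mono (f≤g ∘ suc))

  +-tightˡ : ∀ {p q r s} → p ≤ q → r ≤ s → p + r ≡ q + s → p ≡ q
  +-tightˡ {p} {q} {r} {s} p≤q r≤s eq = ≤-antisym p≤q (begin
    q             ≡⟨ solve 2 (λ q s → q := q :+ s :- s) refl q s ⟩
    q + s - s     ≡⟨ cong (_- s) eq ⟨
    p + r - s     ≤⟨ +-monoʳ-≤ (p + r) (neg-antimono-≤ r≤s) ⟩
    p + r - r     ≡⟨ solve 2 (λ q s → q :+ s :- s := q) refl p r ⟩
    p             ∎)
    where open ≤-Reasoning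

  -- The differences are nonnegative and add up to zero.
  sum-tight : {f g : Fin n → ℚ} → (∀ i → f i ≤ g i) → sum f ≡ sum g → ∀ i → f i ≡ g i
  sum-tight {f = f} {g} f≤g eq zero    = +-tightˡ (f≤g zero) (sum-mono (f≤g ∘ suc)) eq
  sum-tight {f = f} {g} f≤g eq (suc i) = sum-tight (f≤g ∘ suc)
    (+-tightˡ (sum-mono (f≤g ∘ suc)) (f≤g zero)
      (trans (+-comm _ (f zero)) (trans eq (+-comm (g zero) _)))) i

  -- Ordering the edges and removing injective layers.

  order : (Fin w → ℚ) → Layer w → Layer w
  order p T v b with ≤-total (p (T v false)) (p (T v true))
  ... | inj₁ _ = T v b
  ... | inj₂ _ = T v (not b)

  order-≤ : (p : Fin w → ℚ) (T : Layer w) → ∀ v → p (order p T v false) ≤ p (order p T v true)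
  order-≤ p T v with ≤-total (p (T v false)) (p (T v true))
  ... | inj₁ le = le
  ... | inj₂ le = le

  -- The order is decided by `p`, but `q` is arbitrary: `clean` averages both the values and the
  -- remaining variation over the reordered edges.
  order-avg : (p q : Fin w → ℚ) (T : Layer w) → ∀ v →
    avg (q (order p T v false)) (q (order p T v true)) ≡ avg (q (T v false)) (q (T v true))
  order-avg p q T v with ≤-total (p (T v false)) (p (T v true))
  ... | inj₁ _ = refl
  ... | inj₂ _ = cong (½ *_) (+-comm (q (T v true)) (q (T v false)))

  order-gap : (p : Fin w → ℚ) (T : Layer w) → ∀ v →
    gap (p (order p T v false)) (p (order p T v true)) ≡ gap (p (T v false)) (p (T v true))
  order-gap p T v with ≤-total (p (T v false)) (p (T v true))
  ... | inj₁ _ = refl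
  ... | inj₂ _ = gap-sym (p (T v true)) (p (T v false))

  -- Both maps are permutations, so the values at the 0-successors and at the 1-successors both add
  -- up to `sum p`; hence the inequality is tight at every vertex.
  ¬colliding⇒equal : (p : Fin w → ℚ) (T : Layer w) → (∀ v → p (T v false) ≤ p (T v true)) → ¬ Colliding T →
    ∀ v → p (T v false) ≡ p (T v true)
  ¬colliding⇒equal p T p≤ ¬c = sum-tight p≤
    (trans (total false) (sym (total true)))
    where
    total : ∀ b → sum (λ v → p (T v b)) ≡ sum p
    total b = sum-injective p (λ v → T v b) (¬collides⇒injective λ c → ¬c (b , c))

  colliding? : (T : Layer w) → Dec (Colliding T)
  colliding? T with collides? (λ v → T v false) | collides? (λ v → T v true)
  ... | yes c | _     = yes (false , c)
  ... | no  _ | yes c = yes (true , c)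
  ... | no ¬c | no ¬d = no λ { (false , c) → ¬c c ; (true , d) → ¬d d }

  -- A layer whose two maps are injective and ordered preserves the sum of the values,
  -- so the value does not depend on the bit it reads: it can be merged into its successor,
  -- reading from each vertex the bit that leads to the larger remaining variation.
  record Cleaned (Ts : Vec (Layer w) n) (a : Fin w → Bool) : Set where
    field
      {size}    : ℕ
      size≤     : size ℕ.≤ n
      layers    : Vec (Layer w) size
      colliding : All Colliding layers
      entry     : Fin w → Fin w
      val≡      : ∀ v → val Ts a v ≡ val layers a (entry v)
      var≤      : ∀ v → var Ts a v ≤ var layers a (entry v)

  clean : (Ts : Vec (Layer w) n) (a : Fin w → Bool) → Cleaned Ts a
  clean []       a = record { size≤ = ℕ.z≤n ; layers = [] ; colliding = [] ; entry = id
                            ; val≡ = λ _ → refl ; var≤ = λ _ → ≤-refl }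
  clean (T ∷ Ts) a with clean Ts a
  ... | record { size≤ = size≤ ; layers = Us ; colliding = colliding ; entry = h ; val≡ = val≡ ; var≤ = var≤ } = go (colliding? T′)
    where
    p = val Us a
    u = var Us a
    -- The later layers are cleaned first, so the edges are redirected through their entry map
    -- before they are ordered.
    T° = λ v b → h (T v b)
    T′ = order p T°
    val≡′ : ∀ v → val (T ∷ Ts) a v ≡ avg (p (T′ v false)) (p (T′ v true))
    val≡′ v = trans (cong₂ avg (val≡ _) (val≡ _)) (sym (order-avg p p T° v))
    var≤′ : ∀ v → var (T ∷ Ts) a v ≤ var (T′ ∷ Us) a v
    var≤′ v = +-mono-≤
      (≤-reflexive (trans (cong₂ gap (val≡ _) (val≡ _)) (sym (order-gap p T° v))))
      (≤-trans (avg-mono (var≤ _) (var≤ _)) (≤-reflexive (sym (order-avg p u T° v))))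
    heavier : ∀ v → ∃ λ b → avg (u (T′ v false)) (u (T′ v true)) ≤ u (T′ v b)
    heavier v = avg≤larger (u ∘ T′ v)
    go : Dec (Colliding T′) → Cleaned (T ∷ Ts) a
    go (yes c) = record { size≤ = ℕ.s≤s size≤ ; layers = T′ ∷ Us ; colliding = c ∷ colliding ; entry = id
                        ; val≡ = val≡′ ; var≤ = var≤′ }
    go (no ¬c) = record { size≤ = ℕ.m≤n⇒m≤1+n size≤ ; layers = Us ; colliding = colliding
                        ; entry = λ v → T′ v (proj₁ (heavier v))
                        ; val≡ = λ v → trans (val≡′ v) (either v (proj₁ (heavier v)))
                        ; var≤ = λ v → ≤-trans (var≤′ v) (≤-trans (≤-reflexive (still v)) (proj₂ (heavier v))) }
      where
      eq : ∀ v → p (T′ v false) ≡ p (T′ v true)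
      eq = ¬colliding⇒equal p T′ (order-≤ p T°) ¬c
      either : ∀ v b → avg (p (T′ v false)) (p (T′ v true)) ≡ p (T′ v b)
      either v false = trans (cong (avg (p (T′ v false))) (sym (eq v))) (avg-idem (p (T′ v false)))
      either v true  = trans (cong (λ q → avg q (p (T′ v true))) (eq v)) (avg-idem (p (T′ v true)))
      still : ∀ v → var (T′ ∷ Us) a v ≡ avg (u (T′ v false)) (u (T′ v true))
      still v = trans (cong (_+ avg (u (T′ v false)) (u (T′ v true)))
                      (trans (cong (gap (p (T′ v false))) (sym (eq v))) (gap-refl (p (T′ v false)))))
                (+-identityˡ _)

  -- Averages and sums

  E : (Vec Bool n → ℚ) → ℚ
  E {zero}  f = f []
  E {suc n} f = avg (E λ x → f (false ∷ x)) (E λ x → f (true ∷ x))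

  E-cong : {f g : Vec Bool n → ℚ} → (∀ x → f x ≡ g x) → E f ≡ E g
  E-cong {zero}  f≗g = f≗g []
  E-cong {suc n} f≗g = cong₂ avg (E-cong (f≗g ∘ (false ∷_))) (E-cong (f≗g ∘ (true ∷_)))

  E-mono : {f g : Vec Bool n → ℚ} → (∀ x → f x ≤ g x) → E f ≤ E g
  E-mono {zero}  f≤g = f≤g []
  E-mono {suc n} f≤g = avg-mono (E-mono (f≤g ∘ (false ∷_))) (E-mono (f≤g ∘ (true ∷_)))

  E-const : ∀ n p → E {n} (λ _ → p) ≡ p
  E-const zero    p = refl
  E-const (suc n) p = trans (cong₂ avg (E-const n p) (E-const n p)) (avg-idem p)

  E-+ : (f g : Vec Bool n → ℚ) → E (λ x → f x + g x) ≡ E f + E g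
  E-+ {zero}  f g = refl
  E-+ {suc n} f g = trans (cong₂ avg (E-+ (f ∘ (false ∷_)) (g ∘ (false ∷_))) (E-+ (f ∘ (true ∷_)) (g ∘ (true ∷_))))
    (avg-+ (E (f ∘ (false ∷_))) (E (f ∘ (true ∷_))) (E (g ∘ (false ∷_))) (E (g ∘ (true ∷_))))

  E-*ˡ : ∀ r (f : Vec Bool n → ℚ) → E (λ x → r * f x) ≡ r * E f
  E-*ˡ {zero}  r f = refl
  E-*ˡ {suc n} r f = trans (cong₂ avg (E-*ˡ r (f ∘ (false ∷_))) (E-*ˡ r (f ∘ (true ∷_))))
    (solve 3 (λ r a b → con ½ :* (r :* a :+ r :* b) := r :* (con ½ :* (a :+ b))) refl r _ _)

  E-avg : (f g : Vec Bool n → ℚ) → E (λ x → avg (f x) (g x)) ≡ avg (E f) (E g)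
  E-avg f g = trans (E-*ˡ ½ (λ x → f x + g x)) (cong (½ *_) (E-+ f g))

  -- Convexity of the absolute value (Jensen's inequality), one bit at a time.
  gap-E≤ : (f g : Vec Bool n → ℚ) → gap (E f) (E g) ≤ E (λ x → gap (f x) (g x))
  gap-E≤ {zero}  f g = ≤-refl
  gap-E≤ {suc n} f g = ≤-trans (gap-avg≤ (E (f ∘ (false ∷_))) (E (f ∘ (true ∷_))) (E (g ∘ (false ∷_))) (E (g ∘ (true ∷_))))
    (avg-mono (gap-E≤ (f ∘ (false ∷_)) (g ∘ (false ∷_))) (gap-E≤ (f ∘ (true ∷_)) (g ∘ (true ∷_))))

  ∑< : ℕ → (ℕ → ℚ) → ℚ
  ∑< zero    f = 0ℚ
  ∑< (suc m) f = f m + ∑< m f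

  -- `∑<` unfolds at its top index, whereas the class that is live at the first layer has index 0.
  ∑<-suc : ∀ m f → ∑< (suc m) f ≡ f 0 + ∑< m (f ∘ suc)
  ∑<-suc zero    f = refl
  ∑<-suc (suc m) f = trans (cong (f (suc m) +_) (∑<-suc m f))
    (solve 3 (λ p q r → p :+ (q :+ r) := q :+ (p :+ r)) refl (f (suc m)) (f 0) (∑< m (f ∘ suc)))

  ∑<-avg : ∀ m f g → ∑< m (λ c → avg (f c) (g c)) ≡ avg (∑< m f) (∑< m g)
  ∑<-avg zero    f g = refl
  ∑<-avg (suc m) f g = trans (cong (avg (f m) (g m) +_) (∑<-avg m f g)) (sym (avg-+ (f m) (g m) (∑< m f) (∑< m g)))

  ∑<-≤ : ∀ m {f B} → (∀ c → f c ≤ B) → ∑< m f ≤ ι m * B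
  ∑<-≤ zero    {B = B} f≤B = ≤-reflexive (sym (*-zeroˡ B))
  ∑<-≤ (suc m) {B = B} f≤B = ≤-trans (+-mono-≤ (f≤B m) (∑<-≤ m f≤B))
    (≤-reflexive (solve 2 (λ m b → b :+ m :* b := (con 1ℚ :+ m) :* b) refl (ι m) B))

  ∑<-0 : ∀ m → ∑< m (λ _ → 0ℚ) ≡ 0ℚ
  ∑<-0 zero    = refl
  ∑<-0 (suc m) = trans (+-identityˡ _) (∑<-0 m)

  -- Random restrictions

  -- The vertex `j` takes the slot of `i`, which has the same image under `g`, and the remaining
  -- vertices close the hole at `j`.
  compress : {g : Fin (suc w) → Fin (suc w)} → Collides g →
    ∃₂ λ (h : Fin (suc w) → Fin w) (e : Fin w → Fin (suc w)) → ∀ v → e (h v) ≡ g v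
  compress {w} {g} (i , j , i≢j , gi≡gj) = h , g ∘ punchIn j , e∘h
    where
    h : Fin (suc w) → Fin w
    h v with j ≟ᶠ v
    ... | yes _   = punchOut (i≢j ∘ sym)
    ... | no  j≢v = punchOut j≢v
    e∘h : ∀ v → g (punchIn j (h v)) ≡ g v
    e∘h v with j ≟ᶠ v
    ... | yes refl = trans (cong g (punchIn-punchOut (i≢j ∘ sym))) gi≡gj
    ... | no  j≢v  = cong g (punchIn-punchOut j≢v)

  -- Bounds the probability that the current stretch, with `c` dead layers to go, ends uncompressed;
  -- it is zero once the flag is set.
  missBound : Bool → ℕ → ℚ
  missBound s c = if s then 0ℚ else ½^ c

  missBound-true≤ : ∀ s c → missBound true c ≤ missBound s c
  missBound-true≤ true  c = ≤-refl
  missBound-true≤ false c = 0≤½^ c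

  missBound≤½^ : ∀ s c → missBound s c ≤ ½^ c
  missBound≤½^ true  c = 0≤½^ c
  missBound≤½^ false c = ≤-refl

  -- Every (k+1)-st layer is live, the first one after c dead layers; dead layers read a fixed bit of x.
  module _ (k : ℕ) where

    liveVar : ℕ → Vec (Layer w) n → (Fin w → Bool) → Fin w → ℚ
    liveVar c       []       a v = 0ℚ
    liveVar zero    (T ∷ Ts) a v = gap (val Ts a (T v false)) (val Ts a (T v true))
                                 + avg (liveVar k Ts a (T v false)) (liveVar k Ts a (T v true))
    liveVar (suc c) (T ∷ Ts) a v = avg (liveVar c Ts a (T v false)) (liveVar c Ts a (T v true))

    -- The restriction has one bit per layer, and the bits at live layers are ignored. This way the
    -- average over restrictions is the plain average `E` over `Vec Bool n`.
    resVal : ℕ → Vec (Layer w) n → Vec Bool n → (Fin w → Bool) → Fin w → ℚ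
    resVal c       []       []      a v = boolToℚ (a v)
    resVal zero    (T ∷ Ts) (b ∷ x) a v = avg (resVal k Ts x a (T v false)) (resVal k Ts x a (T v true))
    resVal (suc c) (T ∷ Ts) (b ∷ x) a v = resVal c Ts x a (T v b)

    resVar : ℕ → Vec (Layer w) n → Vec Bool n → (Fin w → Bool) → Fin w → ℚ
    resVar c       []       []      a v = 0ℚ
    resVar zero    (T ∷ Ts) (b ∷ x) a v = gap (resVal k Ts x a (T v false)) (resVal k Ts x a (T v true))
                                        + avg (resVar k Ts x a (T v false)) (resVar k Ts x a (T v true))
    resVar (suc c) (T ∷ Ts) (b ∷ x) a v = resVar c Ts x a (T v b)

    E-resVal : ∀ c (Ts : Vec (Layer w) n) a v → E (λ x → resVal c Ts x a v) ≡ val Ts a v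
    E-resVal c       []       a v = refl
    E-resVal zero    (T ∷ Ts) a v = trans (avg-idem _) (trans
      (E-avg (λ x → resVal k Ts x a (T v false)) (λ x → resVal k Ts x a (T v true)))
      (cong₂ avg (E-resVal k Ts a (T v false)) (E-resVal k Ts a (T v true))))
    E-resVal (suc c) (T ∷ Ts) a v = cong₂ avg (E-resVal c Ts a (T v false)) (E-resVal c Ts a (T v true))

    -- At a dead layer, averaging over the fixed bit is averaging over the step. At a live layer the
    -- values are by `E-resVal` the means of the restricted values, and `gap-E≤` moves the mean out
    -- of the gap.
    liveVar≤E-resVar : ∀ c (Ts : Vec (Layer w) n) a v → liveVar c Ts a v ≤ E (λ x → resVar c Ts x a v)
    liveVar≤E-resVar c       []       a v = ≤-refl
    liveVar≤E-resVar zero    (T ∷ Ts) a v = begin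
      gap (val Ts a v₀) (val Ts a v₁) + avg (liveVar k Ts a v₀) (liveVar k Ts a v₁)
        ≡⟨ cong₂ (λ p q → gap p q + avg (liveVar k Ts a v₀) (liveVar k Ts a v₁))
             (E-resVal k Ts a v₀) (E-resVal k Ts a v₁) ⟨
      gap (E p₀) (E p₁) + avg (liveVar k Ts a v₀) (liveVar k Ts a v₁)
        ≤⟨ +-mono-≤ (gap-E≤ p₀ p₁) (avg-mono (liveVar≤E-resVar k Ts a v₀) (liveVar≤E-resVar k Ts a v₁)) ⟩
      E (λ x → gap (p₀ x) (p₁ x)) + avg (E u₀) (E u₁)
        ≡⟨ cong (E (λ x → gap (p₀ x) (p₁ x)) +_) (E-avg u₀ u₁) ⟨
      E (λ x → gap (p₀ x) (p₁ x)) + E (λ x → avg (u₀ x) (u₁ x))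
        ≡⟨ E-+ (λ x → gap (p₀ x) (p₁ x)) (λ x → avg (u₀ x) (u₁ x)) ⟨
      E (λ x → gap (p₀ x) (p₁ x) + avg (u₀ x) (u₁ x))
        ≡⟨ avg-idem _ ⟨
      E (λ x → resVar zero (T ∷ Ts) x a v) ∎
      where
      open ≤-Reasoning
      v₀ = T v false
      v₁ = T v true
      p₀ = λ x → resVal k Ts x a v₀
      p₁ = λ x → resVal k Ts x a v₁
      u₀ = λ x → resVar k Ts x a v₀
      u₁ = λ x → resVar k Ts x a v₁
    liveVar≤E-resVar (suc c) (T ∷ Ts) a v =
      avg-mono (liveVar≤E-resVar c Ts a (T v false)) (liveVar≤E-resVar c Ts a (T v true))

    resVal-bounds : ∀ c (Ts : Vec (Layer w) n) x a v → 0ℚ ≤ resVal c Ts x a v × resVal c Ts x a v ≤ 1ℚ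
    resVal-bounds c       []       []      a v = 0≤boolToℚ (a v) , boolToℚ≤1 (a v)
    resVal-bounds zero    (T ∷ Ts) (b ∷ x) a v =
      let 0≤p , p≤1 = resVal-bounds k Ts x a (T v false)
          0≤q , q≤1 = resVal-bounds k Ts x a (T v true)
      in avg-mono 0≤p 0≤q , avg-mono p≤1 q≤1
    resVal-bounds (suc c) (T ∷ Ts) (b ∷ x) a v = resVal-bounds c Ts x a (T v b)

    -- Crude bound for the restrictions that miss: each layer contributes at most 1.
    resVar≤length : ∀ c (Ts : Vec (Layer w) n) x a v → resVar c Ts x a v ≤ ι n
    resVar≤length c       []       []      a v = ≤-refl
    resVar≤length {n = suc n} zero (T ∷ Ts) (b ∷ x) a v =
      let 0≤p , p≤1 = resVal-bounds k Ts x a (T v false)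
          0≤q , q≤1 = resVal-bounds k Ts x a (T v true)
      in +-mono-≤ (≤-trans (½*-mono (∣p-q∣≤1 0≤p p≤1 0≤q q≤1)) ½≤1)
           (≤-trans (avg-mono (resVar≤length k Ts x a (T v false)) (resVar≤length k Ts x a (T v true)))
                    (≤-reflexive (avg-idem (ι n))))
      where
      ½≤1 : ½ ≤ 1ℚ
      ½≤1 = avg-mono 0≤1 (≤-refl {1ℚ})
    resVar≤length {n = suc n} (suc c) (T ∷ Ts) (b ∷ x) a v =
      ≤-trans (resVar≤length c Ts x a (T v b)) (ι-mono (ℕ.n≤1+n n))

    -- The restriction x misses if some dead stretch that ends at a live layer has no colliding map;
    -- the flag records whether the current stretch has already been compressed.
    misses : Bool → ℕ → Vec (Layer w) n → Vec Bool n → Bool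
    misses s c       []       []      = false
    misses s zero    (T ∷ Ts) (b ∷ x) = not s ∨ misses false k Ts x
    misses s (suc c) (T ∷ Ts) (b ∷ x) = misses (s ∨ does (collides? λ v → T v b)) c Ts x

    -- Union bound over the dead stretches. At a dead layer at least one of the two bits selects a
    -- colliding map, so each dead layer halves the bound on staying uncompressed. Every later
    -- stretch has `k` dead layers before its live one, and there are at most `n` such stretches.
    E-misses≤ : ∀ s c (Ts : Vec (Layer w) n) → All Colliding Ts →
      E (λ x → boolToℚ (misses s c Ts x)) ≤ missBound s c + ι n * ½^ k
    E-misses≤ s c [] [] = +-mono-≤ (missBound-true≤ s c) (≤-reflexive (sym (*-zeroˡ (½^ k))))
    E-misses≤ {n = suc n} true zero (T ∷ Ts) (_ ∷ cs) = begin
      avg q q                       ≡⟨ avg-idem q ⟩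
      q                             ≤⟨ E-misses≤ false k Ts cs ⟩
      -- The stretch that begins after this live layer costs `½^ k`, paid for by the growth from
      -- `ι n` to `ι (suc n)`.
      ½^ k + ι n * ½^ k             ≡⟨ solve 2 (λ h n → h :+ n :* h := con 0ℚ :+ (con 1ℚ :+ n) :* h) refl (½^ k) (ι n) ⟩
      0ℚ + ι (suc n) * ½^ k         ∎
      where
      open ≤-Reasoning
      q = E (λ x → boolToℚ (misses false k Ts x))
    -- Here the miss is certain, and `missBound false 0` is 1.
    E-misses≤ {n = suc n} false zero (T ∷ Ts) _ = begin
      avg (E {n} (λ _ → 1ℚ)) (E {n} (λ _ → 1ℚ)) ≡⟨ cong₂ avg (E-const n 1ℚ) (E-const n 1ℚ) ⟩
      1ℚ                                        ≡⟨ +-identityʳ 1ℚ ⟨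
      1ℚ + 0ℚ                                   ≤⟨ +-monoʳ-≤ 1ℚ (0≤* (0≤ι (suc n)) (0≤½^ k)) ⟩
      1ℚ + ι (suc n) * ½^ k                     ∎
      where open ≤-Reasoning
    E-misses≤ {n = suc n} s (suc c) (T ∷ Ts) ((b , coll) ∷ cs) = begin
      avg (E (λ x → boolToℚ (misses (hit false) c Ts x))) (E (λ x → boolToℚ (misses (hit true) c Ts x)))
        ≤⟨ avg-mono (E-misses≤ (hit false) c Ts cs) (E-misses≤ (hit true) c Ts cs) ⟩
      avg (missBound (hit false) c + rest) (missBound (hit true) c + rest)
        ≡⟨ avg-+ (missBound (hit false) c) (missBound (hit true) c) rest rest ⟩
      avg (missBound (hit false) c) (missBound (hit true) c) + avg rest rest
        ≡⟨ cong (avg (missBound (hit false) c) (missBound (hit true) c) +_) (avg-idem rest) ⟩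
      avg (missBound (hit false) c) (missBound (hit true) c) + rest
        ≤⟨ +-mono-≤ (halve s b coll) (*-monoʳ-≤-½^ (ι-mono (ℕ.n≤1+n n))) ⟩
      missBound s (suc c) + ι (suc n) * ½^ k ∎
      where
      open ≤-Reasoning
      rest = ι n * ½^ k
      hit : Bool → Bool
      hit b = s ∨ does (collides? λ v → T v b)
      -- The colliding bit contributes zero and the other bit at most `½^ c`.
      halve : ∀ s b → Collides (λ v → T v b) →
        avg (missBound (s ∨ does (collides? λ v → T v false)) c) (missBound (s ∨ does (collides? λ v → T v true)) c)
        ≤ missBound s (suc c)
      halve true  b     coll = ≤-refl
      halve false false coll with collides? (λ v → T v false)
      ... | yes _ = ≤-trans (≤-reflexive (cong (½ *_) (+-identityˡ (missBound (does (collides? λ v → T v true)) c)))) (½*-mono (missBound≤½^ (does (collides? λ v → T v true)) c))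
      ... | no ¬c = contradiction coll ¬c
      halve false true  coll with collides? (λ v → T v true)
      ... | yes _ = ≤-trans (≤-reflexive (cong (½ *_) (+-identityʳ (missBound (does (collides? λ v → T v false)) c)))) (½*-mono (missBound≤½^ (does (collides? λ v → T v false)) c))
      ... | no ¬c = contradiction coll ¬c
      *-monoʳ-≤-½^ : ∀ {p q} → p ≤ q → p * ½^ k ≤ q * ½^ k
      *-monoʳ-≤-½^ = *-monoʳ-≤-nonNeg (½^ k) {{nonNegative (0≤½^ k)}}

    -- Simulation of the restricted program on fewer vertices, started from the vertices in the range of e.
    record Simulated {r} (u c : ℕ) (Ts : Vec (Layer w) n) (x : Vec Bool n) (a : Fin w → Bool) (e : Fin r → Fin w) : Set where
      field
        {size} : ℕ
        size≤  : size ℕ.≤ n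
        layers : Vec (Layer u) size
        accept : Fin u → Bool
        entry  : Fin r → Fin u
        val≡   : ∀ s → resVal c Ts x a (e s) ≡ val layers accept (entry s)
        var≡   : ∀ s → resVar c Ts x a (e s) ≡ var layers accept (entry s)

    -- After a collision only the range of `e` has to be followed. A dead layer is composed into
    -- `e`; a live layer becomes a layer of the narrow program, whose edges lead through the entry
    -- map of the next stretch.
    simulate : ∀ {u} c (Ts : Vec (Layer (3 ℕ.+ u)) n) x a → misses true c Ts x ≡ false →
      (e : Fin (2 ℕ.+ u) → Fin (3 ℕ.+ u)) → Simulated (2 ℕ.+ u) c Ts x a e
    -- Before a collision all `3 + u` vertices are followed. Injective fixed maps are absorbed into
    -- `entry` until `compress` applies, which happens before the next live layer because the
    -- restriction does not miss.
    simulate′ : ∀ {u} c (Ts : Vec (Layer (3 ℕ.+ u)) n) x a → misses false c Ts x ≡ false →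
      Simulated (2 ℕ.+ u) c Ts x a id

    simulate c [] [] a _ e = record { size≤ = ℕ.z≤n ; layers = [] ; accept = a ∘ e ; entry = id
                                    ; val≡ = λ _ → refl ; var≡ = λ _ → refl }
    simulate zero (T ∷ Ts) (b ∷ x) a hit e with simulate′ k Ts x a hit
    ... | record { size≤ = size≤ ; layers = Us ; accept = a′ ; entry = h ; val≡ = val≡ ; var≡ = var≡ } =
      record { size≤ = ℕ.s≤s size≤ ; layers = (λ s b → h (T (e s) b)) ∷ Us ; accept = a′ ; entry = id
             ; val≡ = λ s → cong₂ avg (val≡ _) (val≡ _)
             ; var≡ = λ s → cong₂ _+_ (cong₂ gap (val≡ _) (val≡ _)) (cong₂ avg (var≡ _) (var≡ _)) }
    simulate (suc c) (T ∷ Ts) (b ∷ x) a hit e with simulate c Ts x a hit (λ s → T (e s) b)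
    ... | record { size≤ = size≤ ; layers = Us ; accept = a′ ; entry = h ; val≡ = val≡ ; var≡ = var≡ } =
      record { size≤ = ℕ.m≤n⇒m≤1+n size≤ ; layers = Us ; accept = a′ ; entry = h ; val≡ = val≡ ; var≡ = var≡ }

    -- The program ends inside an uncompressed stretch. No live layer follows, so only the
    -- acceptance bit matters, and two vertices can store it.
    simulate′ {u = u} c [] [] a _ = record { size≤ = ℕ.z≤n ; layers = [] ; accept = isSuc ; entry = λ v → code (a v)
                                   ; val≡ = λ v → cong boolToℚ (sym (isSuc-code (a v))) ; var≡ = λ _ → refl }
      where
      isSuc : Fin (2 ℕ.+ u) → Bool
      isSuc zero    = false
      isSuc (suc _) = true
      code : Bool → Fin (2 ℕ.+ u)
      code b = if b then suc zero else zero
      isSuc-code : ∀ b → isSuc (code b) ≡ b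
      isSuc-code false = refl
      isSuc-code true  = refl
    simulate′ zero    (T ∷ Ts) (b ∷ x) a ()
    simulate′ (suc c) (T ∷ Ts) (b ∷ x) a hit with collides? (λ v → T v b)
    ... | no _ with simulate′ c Ts x a hit
    ...   | record { size≤ = size≤ ; layers = Us ; accept = a′ ; entry = h ; val≡ = val≡ ; var≡ = var≡ } =
      record { size≤ = ℕ.m≤n⇒m≤1+n size≤ ; layers = Us ; accept = a′ ; entry = λ v → h (T v b)
             ; val≡ = λ v → val≡ (T v b) ; var≡ = λ v → var≡ (T v b) }
    -- The fixed map splits as `e` after `h`: the rest is simulated from the range of `e`, and `h`
    -- is put in front of the entry map.
    simulate′ (suc c) (T ∷ Ts) (b ∷ x) a hit | yes coll with compress coll
    ... | h , e , e∘h with simulate c Ts x a hit e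
    ...   | record { size≤ = size≤ ; layers = Us ; accept = a′ ; entry = h′ ; val≡ = val≡ ; var≡ = var≡ } =
      record { size≤ = ℕ.m≤n⇒m≤1+n size≤ ; layers = Us ; accept = a′ ; entry = h′ ∘ h
             ; val≡ = λ v → trans (cong (resVal c Ts x a) (sym (e∘h v))) (val≡ (h v))
             ; var≡ = λ v → trans (cong (resVar c Ts x a) (sym (e∘h v))) (var≡ (h v)) }

    -- A restriction that does not miss is simulated with one vertex fewer per layer; a miss costs
    -- at most the length. The hypothesis covers all lengths up to `N`, since the simulation drops
    -- layers.
    resVar≤ : ∀ {u N B} →
      (∀ {m} → m ℕ.≤ N → (Us : Vec (Layer (2 ℕ.+ u)) m) → ∀ a s → var Us a s ≤ B) →
      n ℕ.≤ N → ∀ c (Ts : Vec (Layer (3 ℕ.+ u)) n) x a v →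
      resVar c Ts x a v ≤ B + ι n * boolToℚ (misses true c Ts x)
    resVar≤ {n = n} {B = B} bound n≤N c Ts x a v with misses true c Ts x in hit
    ... | true = ≤-trans (resVar≤length c Ts x a v) (begin
      ι n             ≡⟨ trans (+-identityˡ _) (*-identityʳ (ι n)) ⟨
      -- Applied to the empty program, `bound` says that `B` is nonnegative.
      0ℚ + ι n * 1ℚ   ≤⟨ +-monoˡ-≤ (ι n * 1ℚ) (bound ℕ.z≤n [] (λ _ → true) zero) ⟩
      B + ι n * 1ℚ    ∎)
      where open ≤-Reasoning
    ... | false = begin
      resVar c Ts x a v           ≡⟨ S.var≡ zero ⟩
      var S.layers S.accept (S.entry zero) ≤⟨ bound (ℕ.≤-trans S.size≤ n≤N) S.layers S.accept (S.entry zero) ⟩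
      B                           ≡⟨ trans (cong (B +_) (*-zeroʳ (ι n))) (+-identityʳ B) ⟨
      B + ι n * 0ℚ                ∎
      where
      open ≤-Reasoning
      -- The run starts at a single vertex, so `e` can be constant and the first stretch counts as
      -- compressed from the outset.
      module S = Simulated (simulate c Ts x a hit (λ _ → v))

    -- A miss costs at most `ι n` and has probability at most `ι n * ½^ k`; the flag is set at the
    -- start, so the first stretch adds nothing.
    liveVar≤ : ∀ {u N B} →
      (∀ {m} → m ℕ.≤ N → (Us : Vec (Layer (2 ℕ.+ u)) m) → ∀ a s → var Us a s ≤ B) →
      n ℕ.≤ N → ∀ c (Ts : Vec (Layer (3 ℕ.+ u)) n) → All Colliding Ts → ∀ a v →
      liveVar c Ts a v ≤ B + ι n * (ι n * ½^ k)
    liveVar≤ {n = n} {B = B} bound n≤N c Ts cs a v = begin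
      liveVar c Ts a v                       ≤⟨ liveVar≤E-resVar c Ts a v ⟩
      E (λ x → resVar c Ts x a v)            ≤⟨ E-mono (λ x → resVar≤ bound n≤N c Ts x a v) ⟩
      E (λ x → B + ι n * miss x)             ≡⟨ E-+ (λ _ → B) (λ x → ι n * miss x) ⟩
      E {n} (λ _ → B) + E (λ x → ι n * miss x) ≡⟨ cong₂ _+_ (E-const n B) (E-*ˡ (ι n) miss) ⟩
      B + ι n * E miss                       ≤⟨ +-monoʳ-≤ B (*-monoˡ-≤-nonNeg (ι n) {{nonNegative (0≤ι n)}} (E-misses≤ true c Ts cs)) ⟩
      B + ι n * (0ℚ + ι n * ½^ k)            ≡⟨ cong (λ q → B + ι n * q) (+-identityˡ (ι n * ½^ k)) ⟩
      B + ι n * (ι n * ½^ k)                 ∎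
      where
      open ≤-Reasoning
      miss = λ x → boolToℚ (misses true c Ts x)

    -- Each layer is live for exactly one of the offsets from 0 to `k`.
    var≡∑liveVar : (Ts : Vec (Layer w) n) → ∀ a v → var Ts a v ≡ ∑< (suc k) (λ c → liveVar c Ts a v)
    var≡∑liveVar []       a v = sym (∑<-0 (suc k))
    var≡∑liveVar (T ∷ Ts) a v = sym (begin
      ∑< (suc k) (λ c → liveVar c (T ∷ Ts) a v)
        ≡⟨ ∑<-suc k (λ c → liveVar c (T ∷ Ts) a v) ⟩
      -- Past the first layer, offset 0 continues as `k` and offset `suc c` as `c`, so all `suc k`
      -- offsets occur again.
      g + avg (f₀ k) (f₁ k) + ∑< k (λ c → avg (f₀ c) (f₁ c))
        ≡⟨ +-assoc g (avg (f₀ k) (f₁ k)) _ ⟩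
      g + ∑< (suc k) (λ c → avg (f₀ c) (f₁ c))
        ≡⟨ cong (g +_) (∑<-avg (suc k) f₀ f₁) ⟩
      g + avg (∑< (suc k) f₀) (∑< (suc k) f₁)
        ≡⟨ cong₂ (λ p q → g + avg p q) (var≡∑liveVar Ts a (T v false)) (var≡∑liveVar Ts a (T v true)) ⟨
      var (T ∷ Ts) a v ∎)
      where
      open ≡-Reasoning
      g = gap (val Ts a (T v false)) (val Ts a (T v true))
      f₀ = λ c → liveVar c Ts a (T v false)
      f₁ = λ c → liveVar c Ts a (T v true)

  -- With k = 2L the expected loss from missing restrictions is at most n² / 2^(2L) ≤ 1 per class.
  widen : ∀ {u} L B →
    (∀ {m} → m ℕ.≤ 2 ℕ.^ L → (Us : Vec (Layer (2 ℕ.+ u)) m) → ∀ a s → var Us a s ≤ ι B) →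
    n ℕ.≤ 2 ℕ.^ L → (Ts : Vec (Layer (3 ℕ.+ u)) n) → ∀ a v → var Ts a v ≤ ι (suc (L ℕ.+ L) ℕ.* suc B)
  widen {n = n} L B bound n≤2^L Ts a v = begin
    var Ts a v                             ≤⟨ C.var≤ v ⟩
    var C.layers a (C.entry v)             ≡⟨ var≡∑liveVar k C.layers a (C.entry v) ⟩
    ∑< (suc k) (λ c → liveVar k c C.layers a (C.entry v)) ≤⟨ ∑<-≤ (suc k) each ⟩
    ι (suc k) * ι (suc B)                  ≡⟨ ι-* (suc k) (suc B) ⟨
    ι (suc k ℕ.* suc B)                    ∎
    where
    open ≤-Reasoning
    k = L ℕ.+ L
    module C = Cleaned (clean Ts a)
    m = C.size
    m≤2^L = ℕ.≤-trans C.size≤ n≤2^L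
    m½^L≤1 : ι m * ½^ L ≤ 1ℚ
    m½^L≤1 = ≤-trans (*-monoʳ-≤-nonNeg (½^ L) {{nonNegative (0≤½^ L)}} (ι-mono m≤2^L)) (≤-reflexive (ι2^*½^ L))
    each : ∀ c → liveVar k c C.layers a (C.entry v) ≤ ι (suc B)
    each c = begin
      liveVar k c C.layers a (C.entry v)    ≤⟨ liveVar≤ k bound m≤2^L c C.layers C.colliding a (C.entry v) ⟩
      ι B + ι m * (ι m * ½^ k)              ≡⟨ cong (λ q → ι B + ι m * (ι m * q)) (½^-+ L L) ⟩
      ι B + ι m * (ι m * (½^ L * ½^ L))     ≡⟨ cong (ι B +_) (solve 2 (λ m h → m :* (m :* (h :* h)) := (m :* h) :* (m :* h)) refl (ι m) (½^ L)) ⟩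
      ι B + ι m * ½^ L * (ι m * ½^ L)       ≤⟨ +-monoʳ-≤ (ι B) (*-monoʳ-≤-nonNeg (ι m * ½^ L) {{nonNegative (0≤* (0≤ι m) (0≤½^ L))}} m½^L≤1) ⟩
      ι B + 1ℚ * (ι m * ½^ L)               ≡⟨ cong (ι B +_) (*-identityˡ _) ⟩
      ι B + ι m * ½^ L                      ≤⟨ +-monoʳ-≤ (ι B) m½^L≤1 ⟩
      ι B + 1ℚ                              ≡⟨ +-comm (ι B) 1ℚ ⟩
      ι (suc B)                             ∎

  -- Recursion on the width.

  varBound : ℕ → ℕ → ℕ
  varBound L zero    = 1
  varBound L (suc u) = suc (L ℕ.+ L) ℕ.* suc (varBound L u)

  var≤varBound : ∀ L u → n ℕ.≤ 2 ℕ.^ L → (Ts : Vec (Layer (2 ℕ.+ u)) n) → ∀ a v → var Ts a v ≤ ι (varBound L u)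
  var≤varBound L zero    n≤2^L Ts a v = ≤-trans (var₂≤1 Ts a v) (≤-reflexive (sym (+-identityʳ 1ℚ)))
  var≤varBound L (suc u) n≤2^L = widen L (varBound L u) (var≤varBound L u) n≤2^L

  -- As `L` and the previous bound `b` are at least 1, `2L + 1` is at most `3L` and `b + 1` at most
  -- `2b`. This is the origin of the constant 6.
  varBound≤ : ∀ L u → 1 ℕ.≤ L → varBound L u ℕ.≤ (6 ℕ.* L) ℕ.^ u
  varBound≤ L zero    1≤L = ℕ.≤-refl
  varBound≤ L (suc u) 1≤L = begin
    suc (L ℕ.+ L) ℕ.* suc b      ≤⟨ ℕ.*-mono-≤ (ℕ.+-monoˡ-≤ (L ℕ.+ L) 1≤L) (ℕ.+-monoˡ-≤ b (1≤varBound u)) ⟩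
    (L ℕ.+ (L ℕ.+ L)) ℕ.* (b ℕ.+ b) ≡⟨ ring L b ⟩
    6 ℕ.* L ℕ.* b                ≤⟨ ℕ.*-monoʳ-≤ (6 ℕ.* L) (varBound≤ L u 1≤L) ⟩
    6 ℕ.* L ℕ.* (6 ℕ.* L) ℕ.^ u  ∎
    where
    open ℕ.≤-Reasoning
    b = varBound L u
    1≤varBound : ∀ u → 1 ℕ.≤ varBound L u
    1≤varBound zero    = ℕ.≤-refl
    1≤varBound (suc u) = ℕ.s≤s ℕ.z≤n
    ring : ∀ L b → (L ℕ.+ (L ℕ.+ L)) ℕ.* (b ℕ.+ b) ≡ 6 ℕ.* L ℕ.* b
    ring = solve-∀

  -- Level-one Fourier coefficients

  sumℚ-++ : ∀ xs ys → sumℚ (xs ++ ys) ≡ sumℚ xs + sumℚ ys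
  sumℚ-++ []       ys = sym (+-identityˡ (sumℚ ys))
  sumℚ-++ (x ∷ xs) ys = trans (cong (x +_) (sumℚ-++ xs ys)) (sym (+-assoc x (sumℚ xs) (sumℚ ys)))

  sumℚ-↭ : ∀ {xs ys} → xs ↭ ys → sumℚ xs ≡ sumℚ ys
  sumℚ-↭ ↭.refl         = refl
  sumℚ-↭ (↭.prep x p)   = cong (x +_) (sumℚ-↭ p)
  sumℚ-↭ (↭.swap {ys = ys} x y p) = trans (cong (λ q → x + (y + q)) (sumℚ-↭ p))
    (solve 3 (λ x y s → x :+ (y :+ s) := y :+ (x :+ s)) refl x y (sumℚ ys))
  sumℚ-↭ (↭.trans p q)  = trans (sumℚ-↭ p) (sumℚ-↭ q)

  sumℚ-tabulate : (f : Fin n → ℚ) → sumℚ (List.tabulate f) ≡ sum f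
  sumℚ-tabulate {zero}  f = refl
  sumℚ-tabulate {suc n} f = cong (f zero +_) (sumℚ-tabulate (f ∘ suc))

  sumℚ-allFin : (f : Fin n → ℚ) → sumℚ (map f (allFin n)) ≡ sum f
  sumℚ-allFin f = trans (cong sumℚ (map-tabulate id f)) (sumℚ-tabulate f)

  sumℚ-allInputs : ∀ n (f : Vec Bool n → ℚ) → sumℚ (map f (allInputs n)) * ½^ n ≡ E f
  sumℚ-allInputs zero    f = trans (*-identityʳ _) (+-identityʳ (f []))
  sumℚ-allInputs (suc n) f = begin
    sumℚ (map f (map (false ∷_) xs ++ map (true ∷_) xs)) * (½ * ½^ n)
      ≡⟨ cong (_* (½ * ½^ n)) (trans (cong sumℚ (trans (map-++ f (map (false ∷_) xs) (map (true ∷_) xs))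
           (cong₂ _++_ (sym (map-∘ xs)) (sym (map-∘ xs)))))
           (sumℚ-++ (map f₀ xs) (map f₁ xs))) ⟩
    (sumℚ (map f₀ xs) + sumℚ (map f₁ xs)) * (½ * ½^ n)
      ≡⟨ solve 3 (λ a b h → (a :+ b) :* (con ½ :* h) := con ½ :* (a :* h :+ b :* h)) refl
           (sumℚ (map f₀ xs)) (sumℚ (map f₁ xs)) (½^ n) ⟩
    avg (sumℚ (map f₀ xs) * ½^ n) (sumℚ (map f₁ xs) * ½^ n)
      ≡⟨ cong₂ avg (sumℚ-allInputs n f₀) (sumℚ-allInputs n f₁) ⟩
    E f ∎
    where
    open ≡-Reasoning
    xs = allInputs n
    f₀ = f ∘ (false ∷_)
    f₁ = f ∘ (true ∷_)

  expect≡E : ∀ n (f : Vec Bool n → ℚ) → expect n f ≡ E f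
  expect≡E n f = trans (cong (sumℚ (map f (allInputs n)) *_) (1/2^≡½^ n)) (sumℚ-allInputs n f)

  allInputs-complete : (x : Vec Bool n) → x ∈ allInputs n
  allInputs-complete []          = here refl
  allInputs-complete (false ∷ x) = ∈-++⁺ˡ (∈-map⁺ (false ∷_) (allInputs-complete x))
  allInputs-complete {suc n} (true ∷ x) = ∈-++⁺ʳ (map (false ∷_) (allInputs n)) (∈-map⁺ (true ∷_) (allInputs-complete x))

  allInputs-unique : ∀ n → Unique (allInputs n)
  allInputs-unique zero    = ListAll.[] AllPairs.∷ AllPairs.[]
  allInputs-unique (suc n) = Unique.++⁺
    (Unique.map⁺ ∷-injectiveʳ (allInputs-unique n)) (Unique.map⁺ ∷-injectiveʳ (allInputs-unique n))
    λ (p , q) → disjoint p q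
    where
    disjoint : ∀ {x} → x ∈ map (false ∷_) (allInputs n) → ¬ (x ∈ map (true ∷_) (allInputs n))
    disjoint p q with ∈-map⁻ (false ∷_) p | ∈-map⁻ (true ∷_) q
    ... | _ , _ , refl | _ , _ , ()

  permuteInput-inverse : (σ : Permutation′ n) (x : Vec Bool n) → permuteInput σ (permuteInput (flip σ) x) ≡ x
  permuteInput-inverse σ x = trans
    (tabulate-cong λ i → trans (lookup∘tabulate (λ j → lookup x (σ ⟨$⟩ˡ j)) (σ ⟨$⟩ʳ i)) (cong (lookup x) (inverseˡ σ)))
    (tabulate∘lookup x)

  lookup-permuteInput : (σ : Permutation′ n) (x : Vec Bool n) (i : Fin n) → lookup (permuteInput σ x) (σ ⟨$⟩ˡ i) ≡ lookup x i
  lookup-permuteInput σ x i = trans (lookup∘tabulate _ (σ ⟨$⟩ˡ i)) (cong (lookup x) (inverseʳ σ))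

  -- Both lists are free of repetitions and contain every input.
  map-permuteInput-↭ : (σ : Permutation′ n) → map (permuteInput σ) (allInputs n) ↭ allInputs n
  map-permuteInput-↭ {n} σ = ∼bag⇒↭ (unique∧set⇒bag
    (Unique.map⁺ injective (allInputs-unique n)) (allInputs-unique n)
    (λ {x} → mk⇔ (λ _ → allInputs-complete x)
      (λ _ → subst (_∈ map (permuteInput σ) (allInputs n)) (permuteInput-inverse σ x)
               (∈-map⁺ (permuteInput σ) (allInputs-complete (permuteInput (flip σ) x))))))
    where
    injective : ∀ {x y} → permuteInput σ x ≡ permuteInput σ y → x ≡ y
    injective {x} {y} eq = trans (sym (permuteInput-inverse (flip σ) x))
      (trans (cong (permuteInput (flip σ)) eq) (permuteInput-inverse (flip σ) y))

  E-permuteInput : (σ : Permutation′ n) (f : Vec Bool n → ℚ) → E (f ∘ permuteInput σ) ≡ E f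
  E-permuteInput {n} σ f = begin
    E (f ∘ permuteInput σ)                                 ≡⟨ sumℚ-allInputs n (f ∘ permuteInput σ) ⟨
    sumℚ (map (f ∘ permuteInput σ) (allInputs n)) * ½^ n   ≡⟨ cong (λ s → sumℚ s * ½^ n) (map-∘ (allInputs n)) ⟩
    sumℚ (map f (map (permuteInput σ) (allInputs n))) * ½^ n
      ≡⟨ cong (_* ½^ n) (sumℚ-↭ (↭-map⁺ f (map-permuteInput-↭ σ))) ⟩
    sumℚ (map f (allInputs n)) * ½^ n                      ≡⟨ sumℚ-allInputs n f ⟩
    E f                                                    ∎
    where
    open ≡-Reasoning

  sgn : Bool → ℚ
  sgn b = if b then - 1ℚ else 1ℚ

  parity-⊥ : (x : Vec Bool n) → parity ⊥ x ≡ false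
  parity-⊥ []      = refl
  parity-⊥ (b ∷ x) = parity-⊥ x

  parity-⁅⁆ : (i : Fin n) (x : Vec Bool n) → parity ⁅ i ⁆ x ≡ lookup x i
  parity-⁅⁆ zero    (false ∷ x) = parity-⊥ x
  parity-⁅⁆ zero    (true ∷ x)  = cong not (parity-⊥ x)
  parity-⁅⁆ (suc i) (b ∷ x)     = parity-⁅⁆ i x

  coef : (Vec Bool n → ℚ) → Fin n → ℚ
  coef f i = E λ x → f x * sgn (lookup x i)

  fourier-⁅⁆ : (f : Vec Bool n → ℚ) (i : Fin n) → fourier f ⁅ i ⁆ ≡ coef f i
  fourier-⁅⁆ {n} f i = trans (expect≡E n _) (E-cong λ x → cong (λ b → f x * sgn b) (parity-⁅⁆ i x))

  coef-permuteInput : (σ : Permutation′ n) (f : Vec Bool n → ℚ) (i : Fin n) →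
    coef (f ∘ permuteInput σ) i ≡ coef f (σ ⟨$⟩ˡ i)
  coef-permuteInput σ f i = trans
    (E-cong λ x → cong (λ b → f (permuteInput σ x) * sgn b) (sym (lookup-permuteInput σ x i)))
    (E-permuteInput σ λ y → f y * sgn (lookup y (σ ⟨$⟩ˡ i)))

  sum-avg : (f g : Fin n → ℚ) → sum (λ i → avg (f i) (g i)) ≡ avg (sum f) (sum g)
  sum-avg {zero}  f g = refl
  sum-avg {suc n} f g = trans (cong (avg (f zero) (g zero) +_) (sum-avg (f ∘ suc) (g ∘ suc)))
    (sym (avg-+ (f zero) (g zero) (sum (f ∘ suc)) (sum (g ∘ suc))))

  accepts : (Fin n → Layer w) → (Fin w → Bool) → Fin w → Vec Bool n → ℚ
  accepts T a v x = boolToℚ (a (run T v x))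

  E-accepts : (T : Fin n → Layer w) → ∀ a v → E (accepts T a v) ≡ val (tabulate T) a v
  E-accepts {zero}  T a v = refl
  E-accepts {suc n} T a v = cong₂ avg (E-accepts (T ∘ suc) a (T zero v false)) (E-accepts (T ∘ suc) a (T zero v true))

  -- The coefficient of the first bit is, in absolute value, exactly the first gap. Every later one
  -- is the average of the coefficients of the two subprograms, so the triangle inequality reduces
  -- it to them.
  ∑∣coef∣≤var : (T : Fin n → Layer w) → ∀ a v → sum (λ i → ∣ coef (accepts T a v) i ∣) ≤ var (tabulate T) a v
  ∑∣coef∣≤var {zero}  T a v = ≤-refl
  ∑∣coef∣≤var {suc n} T a v = +-mono-≤ (≤-reflexive first) (begin
    sum (λ i → ∣ avg (coef f₀ i) (coef f₁ i) ∣)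
      ≤⟨ sum-mono (λ i → ∣avg∣≤ (coef f₀ i) (coef f₁ i)) ⟩
    sum (λ i → avg ∣ coef f₀ i ∣ ∣ coef f₁ i ∣)
      ≡⟨ sum-avg (λ i → ∣ coef f₀ i ∣) (λ i → ∣ coef f₁ i ∣) ⟩
    avg (sum λ i → ∣ coef f₀ i ∣) (sum λ i → ∣ coef f₁ i ∣)
      ≤⟨ avg-mono (∑∣coef∣≤var (T ∘ suc) a v₀) (∑∣coef∣≤var (T ∘ suc) a v₁) ⟩
    avg (var Ts a v₀) (var Ts a v₁) ∎)
    where
    open ≤-Reasoning
    Ts = tabulate (T ∘ suc)
    v₀ = T zero v false
    v₁ = T zero v true
    f₀ = accepts (T ∘ suc) a v₀
    f₁ = accepts (T ∘ suc) a v₁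
    first : ∣ coef (accepts T a v) zero ∣ ≡ gap (val Ts a v₀) (val Ts a v₁)
    first = begin-equality
      ∣ avg (E λ x → f₀ x * 1ℚ) (E λ x → f₁ x * - 1ℚ) ∣
        ≡⟨ cong₂ (λ p q → ∣ avg p q ∣)
             (E-cong λ x → *-comm (f₀ x) 1ℚ) (E-cong λ x → *-comm (f₁ x) (- 1ℚ)) ⟩
      ∣ avg (E λ x → 1ℚ * f₀ x) (E λ x → - 1ℚ * f₁ x) ∣
        ≡⟨ cong₂ (λ p q → ∣ avg p q ∣) (E-*ˡ 1ℚ f₀) (E-*ˡ (- 1ℚ) f₁) ⟩
      ∣ avg (1ℚ * E f₀) (- 1ℚ * E f₁) ∣
        ≡⟨ cong ∣_∣ (solve 2 (λ p q → con ½ :* (con 1ℚ :* p :+ con (- 1ℚ) :* q) := con ½ :* (p :- q)) refl (E f₀) (E f₁)) ⟩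
      ∣ ½ * (E f₀ - E f₁) ∣
        ≡⟨ ∣½*∣ (E f₀ - E f₁) ⟩
      gap (E f₀) (E f₁)
        ≡⟨ cong₂ gap (E-accepts (T ∘ suc) a v₀) (E-accepts (T ∘ suc) a v₁) ⟩
      gap (val Ts a v₀) (val Ts a v₁) ∎

  -- By `coef-permuteInput`, the coefficients of `f` are those of the ordered program in another
  -- order.
  L1≤var : (f : Vec Bool n → Bool) (B : OBP n w) (σ : Permutation′ n) →
    (∀ x → f x ≡ evalOBP B (permuteInput σ x)) →
    L1 f ≤ var (tabulate (OBP.trans B)) (OBP.accept B) (OBP.start B)
  L1≤var f B σ f≗ = begin
    L1 f                                        ≡⟨ sumℚ-allFin (λ i → ∣ fourier (boolToℚ ∘ f) ⁅ i ⁆ ∣) ⟩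
    sum (λ i → ∣ fourier (boolToℚ ∘ f) ⁅ i ⁆ ∣) ≡⟨ sum-cong-≗ (λ i → cong ∣_∣ (coef≡ i)) ⟩
    sum (λ i → ∣ coef g (σ ⟨$⟩ˡ i) ∣)           ≡⟨ sum-permute (λ i → ∣ coef g i ∣) (flip σ) ⟨
    sum (λ i → ∣ coef g i ∣)                    ≤⟨ ∑∣coef∣≤var (OBP.trans B) (OBP.accept B) (OBP.start B) ⟩
    var (tabulate (OBP.trans B)) (OBP.accept B) (OBP.start B) ∎
    where
    open ≤-Reasoning
    g = accepts (OBP.trans B) (OBP.accept B) (OBP.start B)
    coef≡ : ∀ i → fourier (boolToℚ ∘ f) ⁅ i ⁆ ≡ coef g (σ ⟨$⟩ˡ i)
    coef≡ i = begin-equality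
      fourier (boolToℚ ∘ f) ⁅ i ⁆   ≡⟨ fourier-⁅⁆ (boolToℚ ∘ f) i ⟩
      coef (boolToℚ ∘ f) i          ≡⟨ E-cong (λ x → cong (λ b → boolToℚ b * sgn (lookup x i)) (f≗ x)) ⟩
      coef (g ∘ permuteInput σ) i   ≡⟨ coef-permuteInput σ g i ⟩
      coef g (σ ⟨$⟩ˡ i)             ∎

  -- The binary logarithm and the final bound.

  1≤⌈log₂⌉ : 2 ℕ.≤ n → 1 ℕ.≤ ⌈log₂ n ⌉
  -- `⌈log₂ 2 ⌉` computes to 1.
  1≤⌈log₂⌉ = ⌈log₂⌉-mono-≤

  -- Strong induction: halving with rounding up lowers the logarithm by one.
  n≤2^⌈log₂n⌉ : ∀ n → n ℕ.≤ 2 ℕ.^ ⌈log₂ n ⌉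
  n≤2^⌈log₂n⌉ = <-rec _ go
    where
    go : ∀ n → (∀ {m} → m ℕ.< n → m ℕ.≤ 2 ℕ.^ ⌈log₂ m ⌉) → n ℕ.≤ 2 ℕ.^ ⌈log₂ n ⌉
    go zero          rec = ℕ.z≤n
    go (suc zero)    rec = ℕ.m^n>0 2 ⌈log₂ 1 ⌉
    go n@(suc (suc _)) rec = begin
      n                                   ≡⟨ ℕ.⌊n/2⌋+⌈n/2⌉≡n n ⟨
      ⌊ n /2⌋ ℕ.+ h                       ≤⟨ ℕ.+-monoˡ-≤ h (ℕ.⌊n/2⌋≤⌈n/2⌉ n) ⟩
      h ℕ.+ h                             ≡⟨ cong (h ℕ.+_) (ℕ.+-identityʳ h) ⟨
      2 ℕ.* h                             ≤⟨ ℕ.*-monoʳ-≤ 2 (rec (ℕ.⌈n/2⌉<n _)) ⟩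
      2 ℕ.^ suc ⌈log₂ h ⌉                 ≡⟨ cong (λ e → 2 ℕ.^ suc e) (⌈log₂⌈n/2⌉⌉≡⌈log₂n⌉∸1 n) ⟩
      2 ℕ.^ suc (⌈log₂ n ⌉ ℕ.∸ 1)         ≡⟨ cong (2 ℕ.^_) (ℕ.m+[n∸m]≡n (1≤⌈log₂⌉ {n} (ℕ.s≤s (ℕ.s≤s ℕ.z≤n)))) ⟩
      2 ℕ.^ ⌈log₂ n ⌉                     ∎
      where
      open ℕ.≤-Reasoning
      h = ⌈ n /2⌉

  L1≤ : ∀ n w → 2 ℕ.≤ n → 2 ℕ.≤ w → (f : Vec Bool n → Bool) → ComputedByROBP n w f →
    L1 f ≤ ι (6 ℕ.* (6 ℕ.* ⌈log₂ n ⌉) ℕ.^ (w ℕ.∸ 2))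
  L1≤ n (suc (suc u)) 2≤n (ℕ.s≤s (ℕ.s≤s _)) f (B , σ , f≗) = begin
    L1 f                               ≤⟨ L1≤var f B σ f≗ ⟩
    var (tabulate (OBP.trans B)) (OBP.accept B) (OBP.start B)
      ≤⟨ var≤varBound L u (n≤2^⌈log₂n⌉ n) (tabulate (OBP.trans B)) (OBP.accept B) (OBP.start B) ⟩
    ι (varBound L u)                   ≤⟨ ι-mono (varBound≤ L u (1≤⌈log₂⌉ 2≤n)) ⟩
    -- A single constant has to serve both as the outer factor and inside the power.
    ι ((6 ℕ.* L) ℕ.^ u)                ≤⟨ ι-mono (ℕ.m≤n*m ((6 ℕ.* L) ℕ.^ u) 6) ⟩
    ι (6 ℕ.* (6 ℕ.* L) ℕ.^ u)          ∎
    where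
    open ≤-Reasoning
    L = ⌈log₂ n ⌉

open import Data.Bool using (Bool)
open import Data.Nat using (ℕ; _≤_; _*_; _^_; _∸_)
open import Data.Nat.Logarithm using (⌈log₂_⌉)
open import Data.Integer using (+_)
open import Data.Rational using (_/_)
import Data.Rational as ℚ
open import Data.Vec using (Vec)
open import Data.Product using (Σ; _×_)
open import Data.Nat using (s≤s; z≤n)
open import Data.Product using (_,_)
open import Relation.Binary.PropositionalEquality using (subst)

theorem1p5 : Σ ℕ λ C → 1 ≤ C ×
    ((n w : ℕ) → 2 ≤ n → 2 ≤ w → (f : Vec Bool n → Bool) → ComputedByROBP n w f →
    L1 f ℚ.≤ (+ (C * (C * ⌈log₂ n ⌉) ^ (w ∸ 2))) / 1)
theorem1p5 = 6 , s≤s z≤n , λ n w 2≤n 2≤w f computed →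
  subst (L1 f ℚ.≤_) (ι≡/1 (6 * (6 * ⌈log₂ n ⌉) ^ (w ∸ 2))) (L1≤ n w 2≤n 2≤w f computed)
  where
  open TotalVariation
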